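{- For $n\geq1$, $$\sum_{\pi\in RS_n}s^{\mathrm{iasc}(\pi)}t^{\mathrm{asc}(\pi)}=\sum_{e\in\mathbf{I}_n(000)}s^{\mathrm{asc}(e)}t^{\mathrm{dist}(e)}.$$
   Context: A permutation $\pi$ of $\{1,\ldots,n\}$ is a Simsun permutation if for every $k\in\{1,\ldots,n\}$ the word obtained from $\pi$ by deleting the values $k+1,\ldots,n$ has no three consecutive letters $w_{i-1}>w_i>w_{i+1}$; $RS_n$ is the set of Simsun permutations of $\{1,\ldots,n\}$. For a permutation, $\mathrm{asc}(\pi)=n-1-\mathrm{des}(\pi)$ with $\mathrm{des}(\pi)=|\{i\in[n-1]:\pi_i>\pi_{i+1}\}|$, and $\mathrm{iasc}(\pi)=\mathrm{asc}(\pi^{ -1})$. $\mathbf{I}_n=\{(e_1,\ldots,e_n): 0\leq e_i<i\}$; $\mathbf{I}_n(000)$ is the set of $e\in\mathbf{I}_n$ with no $i<j<k$ such that $e_i=e_j=e_k$. For $e\in\mathbf{I}_n$, $\mathrm{asc}(e)=|\{i\in[n-1]:e_i<e_{i+1}\}|$ and $\mathrm{dist}(e)$ is the number of distinct positive values among its entries. -}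

module Defs where

open import Data.Bool using (Bool; true; false; _∧_; _∨_; not; if_then_else_)
open import Data.Nat using (ℕ; zero; suc; _+_; _∸_; _<ᵇ_; _≡ᵇ_; _≤ᵇ_)
open import Data.List using (List; []; _∷_; _++_; map; concatMap; length; filterᵇ; upTo)
open import Data.Bool.ListAction using (and; any)

-- Words / permutations are lists of naturals (one-line notation).

insertions : ℕ → List ℕ → List (List ℕ)
insertions x []       = (x ∷ []) ∷ []
insertions x (y ∷ ys) = (x ∷ y ∷ ys) ∷ map (y ∷_) (insertions x ys)

perms : ℕ → List (List ℕ)
perms zero    = [] ∷ []
perms (suc n) = concatMap (insertions (suc n)) (perms n)

des : List ℕ → ℕ
des (x ∷ y ∷ ys) = (if y <ᵇ x then 1 else 0) + des (y ∷ ys)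
des _            = 0

ascP : List ℕ → ℕ
ascP w = length w ∸ 1 ∸ des w

posOf : ℕ → List ℕ → ℕ
posOf v []       = 0
posOf v (x ∷ xs) = if x ≡ᵇ v then 1 else suc (posOf v xs)

inverse : List ℕ → List ℕ
inverse w = map (λ j → posOf (suc j) w) (upTo (length w))

iasc : List ℕ → ℕ
iasc w = ascP (inverse w)

noDoubleDescent : List ℕ → Bool
noDoubleDescent (x ∷ y ∷ z ∷ zs) =
  not ((y <ᵇ x) ∧ (z <ᵇ y)) ∧ noDoubleDescent (y ∷ z ∷ zs)
noDoubleDescent _ = true

restrict : ℕ → List ℕ → List ℕ
restrict k = filterᵇ (λ v → v ≤ᵇ k)

isSimsun : List ℕ → Bool
isSimsun w = and (map (λ j → noDoubleDescent (restrict (suc j) w)) (upTo (length w)))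

RS : ℕ → List (List ℕ)
RS n = filterᵇ isSimsun (perms n)

I : ℕ → List (List ℕ)
I zero    = [] ∷ []
I (suc n) = concatMap (λ e → map (λ x → e ++ (x ∷ [])) (upTo (suc n))) (I n)

countᵇ : ℕ → List ℕ → ℕ
countᵇ v = λ e → length (filterᵇ (λ x → x ≡ᵇ v) e)

avoids000 : List ℕ → Bool
avoids000 e = and (map (λ x → countᵇ x e ≤ᵇ 2) e)

I000 : ℕ → List (List ℕ)
I000 n = filterᵇ avoids000 (I n)

ascI : List ℕ → ℕ
ascI (x ∷ y ∷ ys) = (if x <ᵇ y then 1 else 0) + ascI (y ∷ ys)
ascI _            = 0

-- dist(e) = number of distinct positive values among the entries
-- (entries of e ∈ I_n lie in {0,…,n-1}, so we scan v = 1,…,n)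
dist : List ℕ → ℕ
dist e = length (filterᵇ (λ v → any (λ x → x ≡ᵇ v) e) (map suc (upTo (length e))))

coeff : (List ℕ → ℕ) → (List ℕ → ℕ) → List (List ℕ) → ℕ → ℕ → ℕ
coeff f g xs a b = length (filterᵇ (λ w → (f w ≡ᵇ a) ∧ (g w ≡ᵇ b)) xs)

{-# OPTIONS --safe #-}
-- Both families grow one letter at a time. The largest letter N of a Simsun
-- permutation can be inserted anywhere except directly before a descent top, and
-- a 000-avoiding inversion sequence can be extended by any value used at most
-- once. Record such an object as a word of slots of type old or new, cut by a bar
-- at the last letter added; the next step contributes an ascent (of the inverse,
-- respectively of the sequence) exactly when the slot chosen is right of the bar.
-- Filling the slot c in x c y gives, for permutations,
--   x old ∣ new y  if c = new (one more ascent),   x ∣ new y  if c = old,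
-- and for inversion sequences the same with y new in place of new y.
-- Hence it suffices that the generating function F of the completions of x ∣ y
-- does not change when x and y are permuted separately. For adjacent slots
-- old new versus new old this is the identity
--   F(x ∣ new new y) + t F(x old old ∣ new y) = F(x new ∣ new y) + t F(x old ∣ old new y),
-- which holds because moving the bar past one slot affects a single summand.
module Submission where

open import Defs
open import Data.Nat using (ℕ; _≤_)
open import Relation.Binary.PropositionalEquality using (_≡_)
open import Data.Bool using (Bool; true; false; _∧_; not; if_then_else_)
open import Data.Bool.ListAction using (and; any)
open import Data.Bool.Properties using (⇔→≡; T-≡; ∧-assoc; ∧-identityʳ)
open import Data.List using (List; []; _∷_; _++_; _∷ʳ_; map; concatMap; length; filterᵇ; upTo; applyUpTo; _?∷_)
open import Data.List.Membership.Propositional using (_∈_)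
open import Data.List.Properties using (map-++; map-∘; map-cong-local; map-upTo; length-++-sucʳ; ++-identityʳ)
open import Data.List.Relation.Binary.Permutation.Propositional using (_↭_; refl; prep; swap; trans; ↭-sym)
open import Data.List.Relation.Binary.Permutation.Propositional.Properties using (∷↭∷ʳ)
open import Data.List.Relation.Unary.All as All using (All; []; _∷_)
open import Data.List.Relation.Unary.Any using (here; there)
open import Data.Maybe using (Maybe; just; nothing; maybe′)
open import Data.Nat using (zero; suc; _+_; _∸_; _<_; _<ᵇ_; _≤ᵇ_; _≡ᵇ_; z≤n; s≤s; z<s; s<s)
open import Data.Nat.ListAction using (sum)
open import Data.Nat.ListAction.Properties using (sum-++)
open import Data.Nat.Properties
open import Data.Nat.Tactic.RingSolver using (solve-∀)
open import Data.Product using (_×_; _,_; proj₂)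
open import Data.Sum using (_⊎_; inj₁; inj₂)
open import Function using (_∘_; id; mk⇔; Equivalence)
open import Relation.Binary.PropositionalEquality using (_≢_; refl; sym; cong; cong₂; subst; module ≡-Reasoning)
open import Relation.Nullary using (Dec; yes; no; contradiction)
import Data.List.Relation.Unary.All.Properties as All
import Relation.Binary.PropositionalEquality as ≡

-- Finite sums over lists

∑ : {A : Set} → List A → (A → ℕ) → ℕ
∑ xs g = sum (map g xs)

∑-cong : {A : Set} {g h : A → ℕ} {xs : List A} → All (λ x → g x ≡ h x) xs → ∑ xs g ≡ ∑ xs h
∑-cong = cong sum ∘ map-cong-local

∑-zero : {A : Set} (xs : List A) → ∑ xs (λ _ → 0) ≡ 0
∑-zero []       = refl
∑-zero (_ ∷ xs) = ∑-zero xs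

∑-map : {A B : Set} (f : A → B) (xs : List A) (g : B → ℕ) → ∑ (map f xs) g ≡ ∑ xs (g ∘ f)
∑-map f xs g = cong sum (sym (map-∘ xs))

∑-concatMap : {A B : Set} (f : A → List B) (xs : List A) (g : B → ℕ) →
  ∑ (concatMap f xs) g ≡ ∑ xs (λ x → ∑ (f x) g)
∑-concatMap f []       g = refl
∑-concatMap f (x ∷ xs) g = begin
  sum (map g (f x ++ concatMap f xs))       ≡⟨ cong sum (map-++ g (f x) _) ⟩
  sum (map g (f x) ++ map g (concatMap f xs)) ≡⟨ sum-++ (map g (f x)) _ ⟩
  ∑ (f x) g + ∑ (concatMap f xs) g          ≡⟨ cong (∑ (f x) g +_) (∑-concatMap f xs g) ⟩
  ∑ (f x) g + ∑ xs (λ y → ∑ (f y) g)        ∎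
  where open ≡-Reasoning

∑-filterᵇ : {A : Set} (p : A → Bool) (xs : List A) (g : A → ℕ) →
  ∑ (filterᵇ p xs) g ≡ ∑ xs (λ x → if p x then g x else 0)
∑-filterᵇ p []       g = refl
∑-filterᵇ p (x ∷ xs) g with p x
... | true  = cong (g x +_) (∑-filterᵇ p xs g)
... | false = ∑-filterᵇ p xs g

length-filterᵇ : {A : Set} (p : A → Bool) (xs : List A) →
  length (filterᵇ p xs) ≡ ∑ xs (λ x → if p x then 1 else 0)
length-filterᵇ p []       = refl
length-filterᵇ p (x ∷ xs) with p x
... | true  = cong suc (length-filterᵇ p xs)
... | false = length-filterᵇ p xs

-- Slots of a permutation: new = inside a descent or at the end, old = inside an
-- ascent or at the front. Slots of an inversion sequence: new = unused value,
-- old = value used once.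
data Slot : Set where
  old new : Slot

-- A state x ∣ y has the slots left of the last letter in x, nearest first, and
-- those to its right in y.
∑L ∑R : (List Slot → Slot → List Slot → ℕ) → List Slot → List Slot → ℕ
∑L f []      y = 0
∑L f (c ∷ x) y = f x c y + ∑L f x (c ∷ y)
∑R f x []      = 0
∑R f x (c ∷ y) = f x c y + ∑R f (c ∷ x) y

-- Some positions and values carry no slot. Letting them contribute 0 allows a scan to move the bar
-- past every position or value uniformly.
∑L-?∷ : ∀ f c x y → ∑L f (c ?∷ x) y ≡ maybe′ (λ s → f x s y) 0 c + ∑L f x (c ?∷ y)
∑L-?∷ f (just c) x y = refl
∑L-?∷ f nothing  x y = refl

∑R-?∷ : ∀ f c x y → ∑R f x (c ?∷ y) ≡ maybe′ (λ s → f x s y) 0 c + ∑R f (c ?∷ x) y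
∑R-?∷ f (just c) x y = refl
∑R-?∷ f nothing  x y = refl

∑L-cong : ∀ {f g} → (∀ x c y → f x c y ≡ g x c y) → ∀ x y → ∑L f x y ≡ ∑L g x y
∑L-cong eq []      y = refl
∑L-cong eq (c ∷ x) y = cong₂ _+_ (eq x c y) (∑L-cong eq x (c ∷ y))

∑R-cong : ∀ {f g} → (∀ x c y → f x c y ≡ g x c y) → ∀ x y → ∑R f x y ≡ ∑R g x y
∑R-cong eq x []      = refl
∑R-cong eq x (c ∷ y) = cong₂ _+_ (eq x c y) (∑R-cong eq (c ∷ x) y)

fill : (List Slot → List Slot → ℕ → ℕ) → ℕ → List Slot → Slot → List Slot → ℕ
fill G j x new y = G (old ∷ x) (new ∷ y) (suc j)
fill G j x old y = G x (new ∷ y) j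

fill-shift : ∀ G a j x c y → fill (λ x y j → G x y (j + a)) j x c y ≡ fill G (j + a) x c y
fill-shift G a j x new y = refl
fill-shift G a j x old y = refl

-- The sum of φ over the statistics of all n-step completions of x ∣ y, where i and
-- j are the two statistics accumulated so far.
F : (ℕ → ℕ → ℕ) → ℕ → List Slot → List Slot → ℕ → ℕ → ℕ
F φ zero    x y i j = φ i j
F φ (suc n) x y i j = ∑L (fill (λ x y j → F φ n x y i j) j) x y
                    + ∑R (fill (λ x y j → F φ n x y (suc i) j) j) x y

-- Symmetry of the slot sums on each side of the bar

module _ (f : List Slot → Slot → List Slot → ℕ)
         (resp : ∀ {x x′ y y′} c → x ↭ x′ → y ↭ y′ → f x c y ≡ f x′ c y′)
         (exch : ∀ x y → f (new ∷ x) old y + f x new (old ∷ y) ≡ f (old ∷ x) new y + f x old (new ∷ y))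
  where

  exchange : ∀ c d x y → f (d ∷ x) c y + f x d (c ∷ y) ≡ f (c ∷ x) d y + f x c (d ∷ y)
  exchange old old x y = refl
  exchange old new x y = exch x y
  exchange new old x y = sym (exch x y)
  exchange new new x y = refl

  ∑L-respʳ : ∀ x {y y′} → y ↭ y′ → ∑L f x y ≡ ∑L f x y′
  ∑L-respʳ []      q = refl
  ∑L-respʳ (c ∷ x) q = cong₂ _+_ (resp c refl q) (∑L-respʳ x (prep c q))

  ∑R-respˡ : ∀ {x x′} y → x ↭ x′ → ∑R f x y ≡ ∑R f x′ y
  ∑R-respˡ []      p = refl
  ∑R-respˡ (c ∷ y) p = cong₂ _+_ (resp c p refl) (∑R-respˡ y (prep c p))

  -- For an adjacent transposition, `exchange` handles the first two summands together; in all later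
  -- summands both slots already lie right of the bar, where `∑L-respʳ` applies.
  ∑L-respˡ : ∀ {x x′} → x ↭ x′ → ∀ y → ∑L f x y ≡ ∑L f x′ y
  ∑L-respˡ refl       y = refl
  ∑L-respˡ (prep c p) y = cong₂ _+_ (resp c p refl) (∑L-respˡ p (c ∷ y))
  ∑L-respˡ (swap {xs = x} {ys = x′} c d p) y = begin
    f (d ∷ x) c y + (f x d (c ∷ y) + ∑L f x (d ∷ c ∷ y))  ≡⟨ +-assoc (f (d ∷ x) c y) _ _ ⟨
    f (d ∷ x) c y + f x d (c ∷ y) + ∑L f x (d ∷ c ∷ y)    ≡⟨ cong₂ _+_ (exchange c d x y) (∑L-respʳ x (swap d c refl)) ⟩
    f (c ∷ x) d y + f x c (d ∷ y) + ∑L f x (c ∷ d ∷ y)    ≡⟨ cong₂ _+_ (cong₂ _+_ (resp d (prep c p) refl) (resp c p refl)) (∑L-respˡ p (c ∷ d ∷ y)) ⟩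
    f (c ∷ x′) d y + f x′ c (d ∷ y) + ∑L f x′ (c ∷ d ∷ y) ≡⟨ +-assoc (f (c ∷ x′) d y) _ _ ⟩
    f (c ∷ x′) d y + (f x′ c (d ∷ y) + ∑L f x′ (c ∷ d ∷ y)) ∎
    where open ≡-Reasoning
  ∑L-respˡ (trans p q) y = ≡.trans (∑L-respˡ p y) (∑L-respˡ q y)

  ∑R-respʳ : ∀ {y y′} → y ↭ y′ → ∀ x → ∑R f x y ≡ ∑R f x y′
  ∑R-respʳ refl       x = refl
  ∑R-respʳ (prep c p) x = cong₂ _+_ (resp c refl p) (∑R-respʳ p (c ∷ x))
  ∑R-respʳ (swap {xs = y} {ys = y′} c d p) x = begin
    f x c (d ∷ y) + (f (c ∷ x) d y + ∑R f (d ∷ c ∷ x) y)    ≡⟨ +-assoc (f x c (d ∷ y)) _ _ ⟨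
    f x c (d ∷ y) + f (c ∷ x) d y + ∑R f (d ∷ c ∷ x) y      ≡⟨ cong₂ _+_ swapped (∑R-respˡ y (swap d c refl)) ⟩
    f x d (c ∷ y) + f (d ∷ x) c y + ∑R f (c ∷ d ∷ x) y      ≡⟨ cong₂ _+_ (cong₂ _+_ (resp d refl (prep c p)) (resp c refl p)) (∑R-respʳ p (c ∷ d ∷ x)) ⟩
    f x d (c ∷ y′) + f (d ∷ x) c y′ + ∑R f (c ∷ d ∷ x) y′   ≡⟨ +-assoc (f x d (c ∷ y′)) _ _ ⟩
    f x d (c ∷ y′) + (f (d ∷ x) c y′ + ∑R f (c ∷ d ∷ x) y′) ∎
    where
    open ≡-Reasoning
    swapped : f x c (d ∷ y) + f (c ∷ x) d y ≡ f x d (c ∷ y) + f (d ∷ x) c y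
    swapped = ≡.trans (+-comm (f x c (d ∷ y)) _) (≡.trans (sym (exchange c d x y)) (+-comm (f (d ∷ x) c y) _))
  ∑R-respʳ (trans p q) x = ≡.trans (∑R-respʳ p x) (∑R-respʳ q x)

module _ (φ : ℕ → ℕ → ℕ) where

  private
    -- Moving the bar past a slot only changes whether filling that slot counts
    -- as an ascent, and both slots passed here lead to old ∷ x ∣ new ∷ new ∷ y
    -- with the same statistics when filled.
    bar-exchange : ∀ n x y i j →
      F φ n (new ∷ x) (new ∷ y) i j + F φ n (old ∷ x) (old ∷ new ∷ y) i (suc j)
        ≡ F φ n (old ∷ old ∷ x) (new ∷ y) i (suc j) + F φ n x (new ∷ new ∷ y) i j
    bar-exchange zero    x y i j = +-comm (φ i j) _
    bar-exchange (suc n) x y i j = lemma (F φ n (old ∷ x) (new ∷ new ∷ y) i (suc j)) _ _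
      (F φ n (old ∷ x) (new ∷ new ∷ y) (suc i) (suc j)) _ _
      where
      lemma : ∀ g a b h c d → (g + a + b) + (c + (h + d)) ≡ (g + c + d) + (a + (h + b))
      lemma = solve-∀

  -- Induction on the number of steps: the symmetry for `n` steps gives `resp` and, together with
  -- `bar-exchange`, `exch` for the summands of one more step.
  F-resp-↭ : ∀ n {x x′ y y′} i j → x ↭ x′ → y ↭ y′ → F φ n x y i j ≡ F φ n x′ y′ i j
  F-resp-↭ zero    i j p q = refl
  F-resp-↭ (suc n) {x} {x′} {y} {y′} i j p q = cong₂ _+_
    (≡.trans (∑L-respˡ (fᵢ i) (resp i) (exch i) p y) (∑L-respʳ (fᵢ i) (resp i) (exch i) x′ q))
    (≡.trans (∑R-respˡ (fᵢ (suc i)) (resp (suc i)) (exch (suc i)) y p) (∑R-respʳ (fᵢ (suc i)) (resp (suc i)) (exch (suc i)) q x′))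
    where
    fᵢ : ℕ → List Slot → Slot → List Slot → ℕ
    fᵢ i = fill (λ x y j → F φ n x y i j) j
    resp : ∀ i {x x′ y y′} c → x ↭ x′ → y ↭ y′ → fᵢ i x c y ≡ fᵢ i x′ c y′
    resp i old p q = F-resp-↭ n i j p (prep new q)
    resp i new p q = F-resp-↭ n i (suc j) (prep old p) (prep new q)
    exch : ∀ i x y → fᵢ i (new ∷ x) old y + fᵢ i x new (old ∷ y) ≡ fᵢ i (old ∷ x) new y + fᵢ i x old (new ∷ y)
    -- `fill` puts its `new` slot before the `old` one; swapping them gives the form treated by
    -- `bar-exchange`.
    exch i x y = ≡.trans
      (cong (F φ n (new ∷ x) (new ∷ y) i j +_) (F-resp-↭ n i (suc j) refl (swap new old refl)))
      (bar-exchange n x y i j)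

-- 000-avoiding inversion sequences

<⇒<ᵇ≡true : ∀ {a b} → a < b → (a <ᵇ b) ≡ true
<⇒<ᵇ≡true = Equivalence.to T-≡ ∘ <⇒<ᵇ

≤⇒<ᵇ≡false : ∀ {a b} → a ≤ b → (b <ᵇ a) ≡ false
≤⇒<ᵇ≡false {zero}          z≤n     = refl
≤⇒<ᵇ≡false {suc a} {suc b} (s≤s p) = ≤⇒<ᵇ≡false p

≡ᵇ-refl : ∀ a → (a ≡ᵇ a) ≡ true
≡ᵇ-refl a = Equivalence.to T-≡ (≡⇒≡ᵇ a a refl)

≢⇒≡ᵇ≡false : ∀ {a b} → a ≢ b → (a ≡ᵇ b) ≡ false
≢⇒≡ᵇ≡false {a} {b} a≢b with a ≡ᵇ b in eq
... | false = refl
... | true  = contradiction (≡ᵇ⇒≡ a b (Equivalence.from T-≡ eq)) a≢b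

-- Sums over ranges of values, and slots listed by value

∑[_,+_] : ℕ → ℕ → (ℕ → ℕ) → ℕ
∑[ a ,+ zero  ] g = 0
∑[ a ,+ suc k ] g = g a + ∑[ suc a ,+ k ] g

-- Runs downwards, in the order in which `below` lists the slots left of the bar.
∑< : ℕ → (ℕ → ℕ) → ℕ
∑< zero    g = 0
∑< (suc a) g = g a + ∑< a g

∑-applyUpTo : ∀ (h : ℕ → ℕ) a k g → (∀ i → h i ≡ a + i) → ∑ (applyUpTo h k) g ≡ ∑[ a ,+ k ] g
∑-applyUpTo h a zero    g eq = refl
∑-applyUpTo h a (suc k) g eq = cong₂ _+_
  (cong g (≡.trans (eq 0) (+-identityʳ a)))
  (∑-applyUpTo (h ∘ suc) (suc a) k g (λ i → ≡.trans (eq (suc i)) (+-suc a i)))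

∑-split : ∀ a k g → ∑[ 0 ,+ a + k ] g ≡ ∑< a g + ∑[ a ,+ k ] g
∑-split zero    k g = refl
∑-split (suc a) k g = begin
  ∑[ 0 ,+ suc (a + k) ] g                ≡⟨ cong (λ l → ∑[ 0 ,+ l ] g) (+-suc a k) ⟨
  ∑[ 0 ,+ a + suc k ] g                  ≡⟨ ∑-split a (suc k) g ⟩
  ∑< a g + (g a + ∑[ suc a ,+ k ] g)     ≡⟨ +-assoc (∑< a g) _ _ ⟨
  ∑< a g + g a + ∑[ suc a ,+ k ] g       ≡⟨ cong (_+ ∑[ suc a ,+ k ] g) (+-comm (∑< a g) _) ⟩
  g a + ∑< a g + ∑[ suc a ,+ k ] g       ∎
  where open ≡-Reasoning

∑[]-cong : ∀ a k {g h : ℕ → ℕ} → (∀ u → a ≤ u → g u ≡ h u) → ∑[ a ,+ k ] g ≡ ∑[ a ,+ k ] h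
∑[]-cong a zero    eq = refl
∑[]-cong a (suc k) eq = cong₂ _+_ (eq a ≤-refl) (∑[]-cong (suc a) k (λ u → eq u ∘ <⇒≤))

∑[]-snoc : ∀ a k g → ∑[ a ,+ suc k ] g ≡ ∑[ a ,+ k ] g + g (a + k)
∑[]-snoc a zero    g = ≡.trans (+-identityʳ (g a)) (cong g (sym (+-identityʳ a)))
∑[]-snoc a (suc k) g = begin
  g a + ∑[ suc a ,+ suc k ] g                ≡⟨ cong (g a +_) (∑[]-snoc (suc a) k g) ⟩
  g a + (∑[ suc a ,+ k ] g + g (suc a + k))  ≡⟨ +-assoc (g a) _ _ ⟨
  ∑[ a ,+ suc k ] g + g (suc a + k)          ≡⟨ cong (λ l → ∑[ a ,+ suc k ] g + g l) (+-suc a k) ⟨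
  ∑[ a ,+ suc k ] g + g (a + suc k)          ∎
  where open ≡-Reasoning

∑[]-bump : ∀ a k {g h : ℕ → ℕ} v → a ≤ v → v < a + k → (∀ u → u ≢ v → g u ≡ h u) → g v ≡ suc (h v) →
  ∑[ a ,+ k ] g ≡ suc (∑[ a ,+ k ] h)
∑[]-bump a zero    v a≤v v<a eq eqᵥ = contradiction (subst (v <_) (+-identityʳ a) v<a) (≤⇒≯ a≤v)
∑[]-bump a (suc k) {g} {h} v a≤v v<a eq eqᵥ with a ≟ v
... | yes refl = cong₂ _+_ eqᵥ (∑[]-cong (suc a) k (λ u a<u → eq u (>⇒≢ a<u)))
... | no  a≢v  = ≡.trans
  (cong₂ _+_ (eq a a≢v) (∑[]-bump (suc a) k v (≤∧≢⇒< a≤v a≢v) (subst (v <_) (+-suc a k) v<a) eq eqᵥ))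
  (+-suc (h a) _)

module _ (t : ℕ → Maybe Slot) where

  below : ℕ → List Slot
  below zero    = []
  below (suc a) = t a ?∷ below a

  from : ℕ → ℕ → List Slot
  from a zero    = []
  from a (suc k) = t a ?∷ from (suc a) k

  from-snoc : ∀ a k → from a (suc k) ≡ from a k ++ (t (a + k) ?∷ [])
  from-snoc a zero = cong (λ b → t b ?∷ []) (sym (+-identityʳ a))
  from-snoc a (suc k) rewrite from-snoc (suc a) k | +-suc a k = ?∷-++ (t a)
    where
    ?∷-++ : ∀ c {xs ys : List Slot} → c ?∷ (xs ++ ys) ≡ (c ?∷ xs) ++ ys
    ?∷-++ (just _) = refl
    ?∷-++ nothing  = refl

module _ {t t′ : ℕ → Maybe Slot} where

  below-cong : ∀ a → (∀ {u} → u < a → t u ≡ t′ u) → below t a ≡ below t′ a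
  below-cong zero    eq = refl
  below-cong (suc a) eq = cong₂ _?∷_ (eq ≤-refl) (below-cong a (eq ∘ m<n⇒m<1+n))

  from-cong : ∀ a k → (∀ {u} → a ≤ u → t u ≡ t′ u) → from t a k ≡ from t′ a k
  from-cong a zero    eq = refl
  from-cong a (suc k) eq = cong₂ _?∷_ (eq ≤-refl) (from-cong (suc a) k (eq ∘ <⇒≤))

-- Multiplicities and avoidance of 000

countᵇ-∷ʳ-≡ : ∀ v e → countᵇ v (e ∷ʳ v) ≡ suc (countᵇ v e)
countᵇ-∷ʳ-≡ v [] rewrite ≡ᵇ-refl v = refl
countᵇ-∷ʳ-≡ v (x ∷ e) with x ≡ᵇ v
... | true  = cong suc (countᵇ-∷ʳ-≡ v e)
... | false = countᵇ-∷ʳ-≡ v e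

countᵇ-∷ʳ-≢ : ∀ {u v} e → v ≢ u → countᵇ u (e ∷ʳ v) ≡ countᵇ u e
countᵇ-∷ʳ-≢ [] v≢u rewrite ≢⇒≡ᵇ≡false v≢u = refl
countᵇ-∷ʳ-≢ {u} (x ∷ e) v≢u with x ≡ᵇ u
... | true  = cong suc (countᵇ-∷ʳ-≢ e v≢u)
... | false = countᵇ-∷ʳ-≢ e v≢u

countᵇ-∷ʳ-≤ : ∀ u v e → countᵇ u e ≤ countᵇ u (e ∷ʳ v)
countᵇ-∷ʳ-≤ u v e with v ≟ u
... | yes refl = ≤-trans (n≤1+n _) (≤-reflexive (sym (countᵇ-∷ʳ-≡ v e)))
... | no  v≢u  = ≤-reflexive (sym (countᵇ-∷ʳ-≢ e v≢u))

countᵇ-> : ∀ {u} {e} → All (_< u) e → countᵇ u e ≡ 0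
countᵇ-> [] = refl
countᵇ-> (x<u ∷ e<u) rewrite ≢⇒≡ᵇ≡false (<⇒≢ x<u) = countᵇ-> e<u

AtMostTwice : List ℕ → Set
AtMostTwice e = ∀ v → countᵇ v e ≤ 2

≤⇒≤ᵇ≡true : ∀ {a b} → a ≤ b → (a ≤ᵇ b) ≡ true
≤⇒≤ᵇ≡true = Equivalence.to T-≡ ∘ ≤⇒≤ᵇ

≤ᵇ≡true⇒≤ : ∀ {a b} → (a ≤ᵇ b) ≡ true → a ≤ b
≤ᵇ≡true⇒≤ = ≤ᵇ⇒≤ _ _ ∘ Equivalence.from T-≡

∧≡true⇒ : ∀ {a b} → a ∧ b ≡ true → a ≡ true × b ≡ true
∧≡true⇒ {true} {true} refl = refl , refl

-- `avoids000` tests only values that occur in `e`; a value that `go` never meets has count 0.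
avoids000⇒AtMostTwice : ∀ e → avoids000 e ≡ true → AtMostTwice e
avoids000⇒AtMostTwice e av v with go e av
  where
  go : ∀ e′ → and (map (λ x → countᵇ x e ≤ᵇ 2) e′) ≡ true → (countᵇ v e ≤ᵇ 2) ≡ true ⊎ countᵇ v e′ ≡ 0
  go []       h = inj₂ refl
  go (x ∷ e′) h with ∧≡true⇒ h
  ... | px , h′ with x ≡ᵇ v in eq
  ...   | true  = inj₁ (subst (λ u → (countᵇ u e ≤ᵇ 2) ≡ true) (≡ᵇ⇒≡ x v (Equivalence.from T-≡ eq)) px)
  ...   | false = go e′ h′
... | inj₁ p = ≤ᵇ≡true⇒≤ p
... | inj₂ p = subst (_≤ 2) (sym p) z≤n

AtMostTwice⇒avoids000 : ∀ e → AtMostTwice e → avoids000 e ≡ true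
AtMostTwice⇒avoids000 e amt = go e
  where
  go : ∀ e′ → and (map (λ x → countᵇ x e ≤ᵇ 2) e′) ≡ true
  go []       = refl
  go (x ∷ e′) rewrite ≤⇒≤ᵇ≡true (amt x) = go e′

-- Appending `v` raises only the count of `v`, so the one new condition is that `v` still has a
-- slot.
avoids000-∷ʳ : ∀ e v → avoids000 (e ∷ʳ v) ≡ avoids000 e ∧ (countᵇ v e ≤ᵇ 1)
avoids000-∷ʳ e v = ⇔→≡ (mk⇔ to from′)
  where
  to : avoids000 (e ∷ʳ v) ≡ true → avoids000 e ∧ (countᵇ v e ≤ᵇ 1) ≡ true
  to av = cong₂ _∧_
    (AtMostTwice⇒avoids000 e (λ u → ≤-trans (countᵇ-∷ʳ-≤ u v e) (amt u)))
    (≤⇒≤ᵇ≡true (≤-pred (subst (_≤ 2) (countᵇ-∷ʳ-≡ v e) (amt v))))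
    where
    amt : AtMostTwice (e ∷ʳ v)
    amt = avoids000⇒AtMostTwice (e ∷ʳ v) av
  from′ : avoids000 e ∧ (countᵇ v e ≤ᵇ 1) ≡ true → avoids000 (e ∷ʳ v) ≡ true
  from′ h with ∧≡true⇒ h
  ... | av , c≤1 = AtMostTwice⇒avoids000 (e ∷ʳ v) amt
    where
    amt : AtMostTwice (e ∷ʳ v)
    amt u with v ≟ u
    ... | yes refl = subst (_≤ 2) (sym (countᵇ-∷ʳ-≡ v e)) (s≤s (≤ᵇ≡true⇒≤ c≤1))
    ... | no  v≢u  = subst (_≤ 2) (sym (countᵇ-∷ʳ-≢ e v≢u)) (avoids000⇒AtMostTwice e av u)

-- The statistic `dist` under appending an entry

sign : ℕ → ℕ
sign zero    = 0
sign (suc _) = 1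

dist-sum : ∀ e → dist e ≡ ∑[ 1 ,+ length e ] (λ u → sign (countᵇ u e))
dist-sum e = begin
  dist e
    ≡⟨ length-filterᵇ _ (map suc (upTo (length e))) ⟩
  ∑ (map suc (upTo (length e))) (λ u → if any (_≡ᵇ u) e then 1 else 0)
    ≡⟨ cong (λ us → ∑ us (λ u → if any (_≡ᵇ u) e then 1 else 0)) (map-upTo suc (length e)) ⟩
  ∑ (applyUpTo suc (length e)) (λ u → if any (_≡ᵇ u) e then 1 else 0)
    ≡⟨ ∑-applyUpTo suc 1 (length e) _ (λ _ → refl) ⟩
  ∑[ 1 ,+ length e ] (λ u → if any (_≡ᵇ u) e then 1 else 0)
    ≡⟨ ∑[]-cong 1 (length e) (λ u _ → any-sign u e) ⟩
  ∑[ 1 ,+ length e ] (λ u → sign (countᵇ u e)) ∎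
  where
  open ≡-Reasoning
  any-sign : ∀ u e → (if any (_≡ᵇ u) e then 1 else 0) ≡ sign (countᵇ u e)
  any-sign u [] = refl
  any-sign u (x ∷ e) with x ≡ᵇ u
  ... | true  = refl
  ... | false = any-sign u e

record IsInversionSequence (m : ℕ) (e : List ℕ) : Set where
  field
    length≡   : length e ≡ suc m
    bounded   : All (_≤ m) e
    zeroOccurs : countᵇ 0 e ≢ 0

open IsInversionSequence

length-∷ʳ : ∀ (e : List ℕ) v → length (e ∷ʳ v) ≡ suc (length e)
length-∷ʳ e v = ≡.trans (length-++-sucʳ e v []) (cong (suc ∘ length) (++-identityʳ e))

∷ʳ-isInversionSequence : ∀ {m e v} → IsInversionSequence m e → v ≤ suc m → IsInversionSequence (suc m) (e ∷ʳ v)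
∷ʳ-isInversionSequence {m} {e} {v} ie v≤ = record
  { length≡    = ≡.trans (length-∷ʳ e v) (cong suc (length≡ ie))
  ; bounded    = All.∷ʳ⁺ (All.map m≤n⇒m≤1+n (bounded ie)) v≤
  ; zeroOccurs = λ eq → zeroOccurs ie (n≤0⇒n≡0 (≤-trans (countᵇ-∷ʳ-≤ 0 v e) (≤-reflexive eq)))
  }

I-isInversionSequence : ∀ m → All (IsInversionSequence m) (I (suc m))
I-isInversionSequence zero = record { length≡ = refl ; bounded = z≤n ∷ [] ; zeroOccurs = λ () } ∷ []
I-isInversionSequence (suc m) = All.concat⁺ (All.map⁺ (All.map
  (λ ie → All.map⁺ (All.applyUpTo⁺₁ id (2 + m) (∷ʳ-isInversionSequence ie ∘ ≤-pred)))
  (I-isInversionSequence m)))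

-- `dist` of the longer sequence also scans `2 + m`, which exceeds every entry and contributes 0.
-- Without it, both sequences are scanned over the same range.
dist-∷ʳ : ∀ {m e v} → IsInversionSequence m e → v ≤ suc m →
  ∑[ 1 ,+ suc m ] (λ u → sign (countᵇ u (e ∷ʳ v))) ≡ dist (e ∷ʳ v)
dist-∷ʳ {m} {e} {v} ie v≤ = sym (begin
  dist (e ∷ʳ v)
    ≡⟨ dist-sum (e ∷ʳ v) ⟩
  ∑[ 1 ,+ length (e ∷ʳ v) ] g
    ≡⟨ cong (λ l → ∑[ 1 ,+ l ] g) (length≡ ie′) ⟩
  ∑[ 1 ,+ 2 + m ] g
    ≡⟨ ∑[]-snoc 1 (suc m) g ⟩
  ∑[ 1 ,+ suc m ] g + sign (countᵇ (2 + m) (e ∷ʳ v))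
    ≡⟨ cong (λ c → ∑[ 1 ,+ suc m ] g + sign c) (countᵇ-> (All.map s≤s (bounded ie′))) ⟩
  ∑[ 1 ,+ suc m ] g + 0
    ≡⟨ +-identityʳ _ ⟩
  ∑[ 1 ,+ suc m ] g ∎)
  where
  open ≡-Reasoning
  g : ℕ → ℕ
  g u = sign (countᵇ u (e ∷ʳ v))
  ie′ : IsInversionSequence (suc m) (e ∷ʳ v)
  ie′ = ∷ʳ-isInversionSequence ie v≤

dist-repeat : ∀ {m e v c} → IsInversionSequence m e → v ≤ suc m → countᵇ v e ≡ suc c → dist (e ∷ʳ v) ≡ dist e
dist-repeat {m} {e} {v} ie v≤ eq = begin
  dist (e ∷ʳ v)                                   ≡⟨ dist-∷ʳ ie v≤ ⟨
  ∑[ 1 ,+ suc m ] (λ u → sign (countᵇ u (e ∷ʳ v))) ≡⟨ ∑[]-cong 1 (suc m) (λ u _ → same u) ⟩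
  ∑[ 1 ,+ suc m ] (λ u → sign (countᵇ u e))        ≡⟨ cong (λ l → ∑[ 1 ,+ l ] (λ u → sign (countᵇ u e))) (length≡ ie) ⟨
  ∑[ 1 ,+ length e ] (λ u → sign (countᵇ u e))     ≡⟨ dist-sum e ⟨
  dist e                                           ∎
  where
  open ≡-Reasoning
  same : ∀ u → sign (countᵇ u (e ∷ʳ v)) ≡ sign (countᵇ u e)
  same u with v ≟ u
  ... | yes refl rewrite countᵇ-∷ʳ-≡ v e | eq = refl
  ... | no  v≢u  = cong sign (countᵇ-∷ʳ-≢ e v≢u)

dist-fresh : ∀ {m e v} → IsInversionSequence m e → v ≤ suc m → countᵇ v e ≡ 0 → dist (e ∷ʳ v) ≡ suc (dist e)
dist-fresh {m} {e} {v} ie v≤ eq = begin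
  dist (e ∷ʳ v)                                      ≡⟨ dist-∷ʳ ie v≤ ⟨
  ∑[ 1 ,+ suc m ] (λ u → sign (countᵇ u (e ∷ʳ v)))    ≡⟨ ∑[]-bump 1 (suc m) v v>0 (s≤s v≤) (λ u u≢v → cong sign (countᵇ-∷ʳ-≢ e (u≢v ∘ sym))) bump ⟩
  suc (∑[ 1 ,+ suc m ] (λ u → sign (countᵇ u e)))     ≡⟨ cong (λ l → suc (∑[ 1 ,+ l ] (λ u → sign (countᵇ u e)))) (length≡ ie) ⟨
  suc (∑[ 1 ,+ length e ] (λ u → sign (countᵇ u e)))  ≡⟨ cong suc (dist-sum e) ⟨
  suc (dist e)                                        ∎
  where
  open ≡-Reasoning
  v>0 : 0 < v
  v>0 = n≢0⇒n>0 (λ { refl → zeroOccurs ie eq })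
  bump : sign (countᵇ v (e ∷ʳ v)) ≡ suc (sign (countᵇ v e))
  bump rewrite countᵇ-∷ʳ-≡ v e | eq = refl

-- Ascents and slots of an inversion sequence

lastEntry : List ℕ → ℕ
lastEntry []          = 0
lastEntry (x ∷ [])    = x
lastEntry (_ ∷ y ∷ e) = lastEntry (y ∷ e)

lastEntry-∷ʳ : ∀ e v → lastEntry (e ∷ʳ v) ≡ v
lastEntry-∷ʳ []          v = refl
lastEntry-∷ʳ (x ∷ [])    v = refl
lastEntry-∷ʳ (_ ∷ y ∷ e) v = lastEntry-∷ʳ (y ∷ e) v

lastEntry-≤ : ∀ {m} e → All (_≤ m) e → lastEntry e ≤ m
lastEntry-≤ []          []            = z≤n
lastEntry-≤ (x ∷ [])    (x≤ ∷ [])     = x≤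
lastEntry-≤ (_ ∷ y ∷ e) (_ ∷ h)       = lastEntry-≤ (y ∷ e) h

ascI-∷ʳ : ∀ x e v → ascI ((x ∷ e) ∷ʳ v) ≡ (if lastEntry (x ∷ e) <ᵇ v then suc (ascI (x ∷ e)) else ascI (x ∷ e))
ascI-∷ʳ x [] v with x <ᵇ v
... | true  = refl
... | false = refl
ascI-∷ʳ x (y ∷ e) v rewrite ascI-∷ʳ y e v with lastEntry (y ∷ e) <ᵇ v
... | true  = +-suc _ _
... | false = refl

slotOf : ℕ → Maybe Slot
slotOf 0             = just new
slotOf 1             = just old
slotOf (suc (suc _)) = nothing

slotI : List ℕ → ℕ → Maybe Slot
slotI e v = slotOf (countᵇ v e)

-- Repeating the last entry makes no ascent, so its slot is left of the bar. The next entry may be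
-- as large as `length e`, which fixes the number of values on the right.
leftI rightI : List ℕ → List Slot
leftI  e = below (slotI e) (suc (lastEntry e))
rightI e = from (slotI e) (suc (lastEntry e)) (length e ∸ lastEntry e)

weightI : (ℕ → ℕ → ℕ) → ℕ → List ℕ → ℕ
weightI φ n e = F φ n (leftI e) (rightI e) (ascI e) (dist e)

-- One step of growth for inversion sequences

module _ (φ : ℕ → ℕ → ℕ) (n : ℕ) where

  private
    extend : List ℕ → ℕ → ℕ
    extend e v = if countᵇ v e ≤ᵇ 1 then weightI φ n (e ∷ʳ v) else 0

    filled : List ℕ → Bool → List Slot → Slot → List Slot → ℕ
    filled e b = fill (λ x y j → F φ n x y (if b then suc (ascI e) else ascI e) j) (dist e)

  -- Appending `v` moves the bar to just above `v` and affects no other multiplicity; the slot of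
  -- `v` turns from `new` to `old` or from `old` to none. Here `k` counts the available values above
  -- `v`, beyond which `2 + m` becomes available.
  extend-slot : ∀ {m e} → IsInversionSequence m e → ∀ v k → v + k ≡ suc m →
    extend e v ≡ maybe′ (λ c → filled e (lastEntry e <ᵇ v) (below (slotI e) v) c (from (slotI e) (suc v) k)) 0 (slotI e v)
  extend-slot {m} {e} ie v k v+k≡ = main (countᵇ v e) refl
    where
    e′ : List ℕ
    e′ = e ∷ʳ v
    v≤ : v ≤ suc m
    v≤ = subst (v ≤_) v+k≡ (m≤m+n v k)
    ie′ : IsInversionSequence (suc m) e′
    ie′ = ∷ʳ-isInversionSequence ie v≤
    unchanged : ∀ {u} → v ≢ u → slotI e′ u ≡ slotI e u
    unchanged v≢u = cong slotOf (countᵇ-∷ʳ-≢ e v≢u)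
    left≡ : leftI e′ ≡ slotI e′ v ?∷ below (slotI e) v
    left≡ rewrite lastEntry-∷ʳ e v = cong (slotI e′ v ?∷_) (below-cong v (unchanged ∘ >⇒≢))
    rest≡ : length e′ ∸ v ≡ suc k
    rest≡ rewrite length≡ ie′ | sym v+k≡ | sym (+-suc v k) = m+n∸m≡n v (suc k)
    top : slotI e′ (suc v + k) ≡ just new
    top rewrite v+k≡ = cong slotOf (countᵇ-> (All.map s≤s (bounded ie′)))
    -- The slot of `2 + m` comes last, whereas `fill` puts its `new` slot next to the bar; `weight≡`
    -- absorbs the difference by `F-resp-↭`.
    right↭ : rightI e′ ↭ new ∷ from (slotI e) (suc v) k
    right↭ rewrite lastEntry-∷ʳ e v | rest≡ | from-snoc (slotI e′) (suc v) k | top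
                 | from-cong {slotI e′} {slotI e} (suc v) k (unchanged ∘ <⇒≢) = ↭-sym (∷↭∷ʳ new _)
    asc≡ : ascI e′ ≡ (if lastEntry e <ᵇ v then suc (ascI e) else ascI e)
    asc≡ = go e (length≡ ie)
      where
      go : ∀ e → length e ≡ suc m → ascI (e ∷ʳ v) ≡ (if lastEntry e <ᵇ v then suc (ascI e) else ascI e)
      go (x ∷ e) _ = ascI-∷ʳ x e v
    weight≡ : ∀ {x j} → leftI e′ ≡ x → dist e′ ≡ j → weightI φ n e′ ≡ F φ n x (new ∷ from (slotI e) (suc v) k) (if lastEntry e <ᵇ v then suc (ascI e) else ascI e) j
    weight≡ refl refl = ≡.trans (cong (λ i → F φ n (leftI e′) (rightI e′) i (dist e′)) asc≡) (F-resp-↭ φ n _ _ refl right↭)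
    filledAt : Maybe Slot → ℕ
    filledAt = maybe′ (λ c → filled e (lastEntry e <ᵇ v) (below (slotI e) v) c (from (slotI e) (suc v) k)) 0
    guarded : ∀ {c} → countᵇ v e ≡ c → extend e v ≡ (if c ≤ᵇ 1 then weightI φ n e′ else 0)
    guarded = cong (λ c → if c ≤ᵇ 1 then weightI φ n e′ else 0)
    left-at : ∀ {c} → countᵇ v e ≡ c → leftI e′ ≡ slotOf (suc c) ?∷ below (slotI e) v
    left-at eq = ≡.trans left≡ (cong (λ c → slotOf c ?∷ below (slotI e) v) (≡.trans (countᵇ-∷ʳ-≡ v e) (cong suc eq)))
    main : ∀ c → countᵇ v e ≡ c → extend e v ≡ filledAt (slotI e v)
    main 0 eq = ≡.trans (guarded eq)
      (≡.trans (weight≡ (left-at eq) (dist-fresh ie v≤ eq)) (cong (filledAt ∘ slotOf) (sym eq)))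
    main 1 eq = ≡.trans (guarded eq)
      (≡.trans (weight≡ (left-at eq) (dist-repeat ie v≤ eq)) (cong (filledAt ∘ slotOf) (sym eq)))
    main (suc (suc c)) eq = ≡.trans (guarded eq) (cong (filledAt ∘ slotOf) (sym eq))

  module _ {m e} (ie : IsInversionSequence m e) where

    -- Values up to the last entry make no ascent when appended, hence the flag `false`; in
    -- `extend-right` every value makes one.
    extend-left : ∀ a k → a + k ≡ 2 + m → a ≤ suc (lastEntry e) →
      ∑< a (extend e) ≡ ∑L (filled e false) (below (slotI e) a) (from (slotI e) a k)
    extend-left zero    k eq a≤ = refl
    extend-left (suc a) k eq a≤ = ≡.trans
      (cong₂ _+_
        (≡.trans (extend-slot ie a k (suc-injective eq))
          (cong (λ b → maybe′ (λ c → filled e b (below (slotI e) a) c (from (slotI e) (suc a) k)) 0 (slotI e a)) (≤⇒<ᵇ≡false (≤-pred a≤))))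
        (extend-left a (suc k) (≡.trans (+-suc a k) eq) (<⇒≤ a≤)))
      (sym (∑L-?∷ _ (slotI e a) (below (slotI e) a) (from (slotI e) (suc a) k)))

    extend-right : ∀ a k → a + k ≡ 2 + m → lastEntry e < a →
      ∑[ a ,+ k ] (extend e) ≡ ∑R (filled e true) (below (slotI e) a) (from (slotI e) a k)
    extend-right a zero    eq l<a = refl
    extend-right a (suc k) eq l<a = ≡.trans
      (cong₂ _+_
        (≡.trans (extend-slot ie a k (suc-injective (≡.trans (sym (+-suc a k)) eq)))
          (cong (λ b → maybe′ (λ c → filled e b (below (slotI e) a) c (from (slotI e) (suc a) k)) 0 (slotI e a)) (<⇒<ᵇ≡true l<a)))
        (extend-right (suc a) k (≡.trans (sym (+-suc a k)) eq) (m<n⇒m<1+n l<a)))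
      (sym (∑R-?∷ _ (slotI e a) (below (slotI e) a) (from (slotI e) (suc a) k)))

    extend-sum : ∑ (upTo (2 + m)) (extend e) ≡ weightI φ (suc n) e
    extend-sum = begin
      ∑ (upTo (2 + m)) (extend e)                           ≡⟨ ∑-applyUpTo id 0 (2 + m) (extend e) (λ _ → refl) ⟩
      ∑[ 0 ,+ 2 + m ] (extend e)                            ≡⟨ cong (λ l → ∑[ 0 ,+ l ] (extend e)) split ⟨
      ∑[ 0 ,+ suc l + (length e ∸ l) ] (extend e)           ≡⟨ ∑-split (suc l) (length e ∸ l) (extend e) ⟩
      ∑< (suc l) (extend e) + ∑[ suc l ,+ length e ∸ l ] (extend e)
                                                            ≡⟨ cong₂ _+_ (extend-left (suc l) _ split ≤-refl) (extend-right (suc l) _ split ≤-refl) ⟩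
      weightI φ (suc n) e ∎
      where
      open ≡-Reasoning
      l : ℕ
      l = lastEntry e
      split : suc l + (length e ∸ l) ≡ 2 + m
      split = cong suc (≡.trans (m+[n∸m]≡n (≤-trans (lastEntry-≤ e (bounded ie)) (≤-trans (n≤1+n m) (≤-reflexive (sym (length≡ ie)))))) (length≡ ie))

  I000-step : ∀ m → ∑ (I000 (2 + m)) (weightI φ n) ≡ ∑ (I000 (suc m)) (weightI φ (suc n))
  I000-step m = begin
    ∑ (I000 (2 + m)) (weightI φ n)
      ≡⟨ ∑-filterᵇ avoids000 (I (2 + m)) (weightI φ n) ⟩
    ∑ (I (2 + m)) g
      ≡⟨ ∑-concatMap (λ e → map (e ∷ʳ_) (upTo (2 + m))) (I (suc m)) g ⟩
    ∑ (I (suc m)) (λ e → ∑ (map (e ∷ʳ_) (upTo (2 + m))) g)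
      ≡⟨ ∑-cong (All.map (λ {e} → step e) (I-isInversionSequence m)) ⟩
    ∑ (I (suc m)) (λ e → if avoids000 e then weightI φ (suc n) e else 0)
      ≡⟨ ∑-filterᵇ avoids000 (I (suc m)) (weightI φ (suc n)) ⟨
    ∑ (I000 (suc m)) (weightI φ (suc n)) ∎
    where
    open ≡-Reasoning
    g : List ℕ → ℕ
    g e = if avoids000 e then weightI φ n e else 0
    step : ∀ e → IsInversionSequence m e → ∑ (map (e ∷ʳ_) (upTo (2 + m))) g ≡ (if avoids000 e then weightI φ (suc n) e else 0)
    step e ie = begin
      ∑ (map (e ∷ʳ_) (upTo (2 + m))) g   ≡⟨ ∑-map (e ∷ʳ_) (upTo (2 + m)) g ⟩
      ∑ (upTo (2 + m)) (λ v → g (e ∷ʳ v)) ≡⟨ ∑-cong (All.universal (λ v → cong (λ b → if b then weightI φ n (e ∷ʳ v) else 0) (avoids000-∷ʳ e v)) (upTo (2 + m))) ⟩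
      ∑ (upTo (2 + m)) (λ v → if avoids000 e ∧ (countᵇ v e ≤ᵇ 1) then weightI φ n (e ∷ʳ v) else 0) ≡⟨ cases (avoids000 e) ⟩
      (if avoids000 e then weightI φ (suc n) e else 0) ∎
      where
      cases : ∀ b → ∑ (upTo (2 + m)) (λ v → if b ∧ (countᵇ v e ≤ᵇ 1) then weightI φ n (e ∷ʳ v) else 0) ≡ (if b then weightI φ (suc n) e else 0)
      cases true  = extend-sum ie
      cases false = ∑-zero (upTo (2 + m))

∑-I000 : ∀ φ n m → ∑ (I000 (n + suc m)) (λ e → φ (ascI e) (dist e)) ≡ ∑ (I000 (suc m)) (weightI φ n)
∑-I000 φ zero    m = refl
∑-I000 φ (suc n) m = begin
  ∑ (I000 (suc n + suc m)) (λ e → φ (ascI e) (dist e)) ≡⟨ cong (λ l → ∑ (I000 l) (λ e → φ (ascI e) (dist e))) (+-suc n (suc m)) ⟨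
  ∑ (I000 (n + (2 + m))) (λ e → φ (ascI e) (dist e))   ≡⟨ ∑-I000 φ n (suc m) ⟩
  ∑ (I000 (2 + m)) (weightI φ n)                     ≡⟨ I000-step φ n m ⟩
  ∑ (I000 (suc m)) (weightI φ (suc n))               ∎
  where open ≡-Reasoning

-- Simsun permutations

-- Avoids the truncated subtraction of `ascP`. The first pair is added on the right, so that passing
-- a letter becomes the shift `j + a` of `fill-shift`.
asc : List ℕ → ℕ
asc (x ∷ y ∷ ys) = asc (y ∷ ys) + (if y <ᵇ x then 0 else 1)
asc _            = 0

ascP≡asc : ∀ w → ascP w ≡ asc w
ascP≡asc []      = refl
ascP≡asc (x ∷ w) = ≡.trans (cong (_∸ des (x ∷ w)) (sym (des+asc x w))) (m+n∸m≡n (des (x ∷ w)) _)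
  where
  des+asc : ∀ x w → des (x ∷ w) + asc (x ∷ w) ≡ length w
  des+asc x []      = refl
  des+asc x (y ∷ w) with y <ᵇ x
  ... | true  rewrite +-identityʳ (asc (y ∷ w)) = cong suc (des+asc y w)
  ... | false rewrite +-comm (asc (y ∷ w)) 1 | +-suc (des (y ∷ w)) (asc (y ∷ w)) = cong suc (des+asc y w)

desc : ℕ → List ℕ → Bool
desc z []      = false
desc z (y ∷ _) = y <ᵇ z

-- The slot directly before z in … p z zs. Descent tops have none, since filling
-- it creates a double descent; the letter 0 is a sentinel in front of the word.
slotP : ℕ → ℕ → List ℕ → Maybe Slot
slotP p z zs = if (0 <ᵇ z) ∧ not (desc z zs) then just (if z <ᵇ p then new else old) else nothing

slotsP : ℕ → List ℕ → List Slot
slotsP p []       = new ∷ []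
slotsP p (z ∷ zs) = slotP p z zs ?∷ slotsP z zs

-- The accumulator reverses the order, leaving the slot nearest to the bar in front. The slot
-- directly before `m` still counts as left.
leftFrom : ℕ → List Slot → ℕ → List ℕ → List Slot
leftFrom m x p []       = x
leftFrom m x p (z ∷ zs) =
  if z ≡ᵇ m then slotP p z zs ?∷ x else leftFrom m (slotP p z zs ?∷ x) z zs

rightP : ℕ → List ℕ → List Slot
rightP m []       = []
rightP m (z ∷ zs) = if z ≡ᵇ m then slotsP z zs else rightP m zs

precedes : ℕ → ℕ → List ℕ → Bool
precedes m N []       = false
precedes m N (z ∷ zs) = if z ≡ᵇ N then false else if z ≡ᵇ m then true else precedes m N zs

noDoubleDescent-∷∷ : ∀ x y zs →
  noDoubleDescent (x ∷ y ∷ zs) ≡ not ((y <ᵇ x) ∧ desc y zs) ∧ noDoubleDescent (y ∷ zs)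
noDoubleDescent-∷∷ x y []      with y <ᵇ x
... | true  = refl
... | false = refl
noDoubleDescent-∷∷ x y (z ∷ zs) = refl

-- Inserting the largest letter

Letter : ℕ → ℕ → Set
Letter N v = 0 < v × v < N

module _ (N : ℕ) where

  -- A scan of the word with `p` and `z` the last two letters passed and `N` somewhere in `w`. The
  -- slot before `z` is kept out of `x`, since the first letter of `w` decides whether `z` is a
  -- descent top.
  insertWeight : (List Slot → List Slot → ℕ → ℕ) → ℕ → ℕ → List Slot → List ℕ → ℕ
  insertWeight G p z x w =
    if noDoubleDescent (p ∷ z ∷ w) then G (leftFrom N (slotP p z w ?∷ x) z w) (rightP N w) (asc (z ∷ w)) else 0

  insert-end : ∀ G p z x → z < N →
    insertWeight G p z x (N ∷ []) ≡ fill G 0 (slotP p z [] ?∷ x) new []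
  insert-end G p z x z<N
    rewrite noDoubleDescent-∷∷ p z (N ∷ []) | ≤⇒<ᵇ≡false (<⇒≤ z<N) | ≡ᵇ-refl N | <⇒<ᵇ≡true (m<n⇒0<n z<N) with z <ᵇ p
  ... | true  = refl
  ... | false = refl

  -- If `z′` is a descent top, inserting `N` before it creates a double descent, and `z′` has no
  -- slot: both sides are 0. Otherwise the position is a slot, and the cases verify the rule of
  -- `fill`.
  insert-before : ∀ G p z z′ zs x → z < N → Letter N z′ → noDoubleDescent (p ∷ z ∷ z′ ∷ zs) ≡ true →
    insertWeight G p z x (N ∷ z′ ∷ zs) ≡
    maybe′ (λ c → fill G (asc (z ∷ z′ ∷ zs)) (slotP p z (z′ ∷ zs) ?∷ x) c (slotsP z′ zs)) 0 (slotP z z′ zs)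
  insert-before G p z z′ zs x z<N (0<z′ , z′<N) ndd
    rewrite noDoubleDescent-∷∷ N z′ zs | noDoubleDescent-∷∷ z z′ zs
          | ≤⇒<ᵇ≡false (<⇒≤ z<N) | <⇒<ᵇ≡true z′<N | ≡ᵇ-refl N | <⇒<ᵇ≡true 0<z′ | <⇒<ᵇ≡true (m<n⇒0<n z<N)
          | +-identityʳ (asc (z′ ∷ zs)) | +-comm (asc (z′ ∷ zs)) 1
    with z′ <ᵇ z in z′<z | z <ᵇ p | desc z′ zs | noDoubleDescent (z′ ∷ zs)
  -- Here `z` ceases to be a descent top and its slot returns as `old`; `0 < z′ < z` shows that `z`
  -- is not the sentinel.
  ... | true  | false | false | true
    rewrite <⇒<ᵇ≡true (<-trans 0<z′ (<ᵇ⇒< z′ z (Equivalence.from T-≡ z′<z))) | +-identityʳ (asc (z′ ∷ zs)) = refl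
  ... | false | true  | true  | true = refl
  ... | false | true  | false | true rewrite +-comm (asc (z′ ∷ zs)) 1 = refl
  ... | false | false | true  | true = refl
  ... | false | false | false | true rewrite +-comm (asc (z′ ∷ zs)) 1 = refl

  -- With `N` behind `z′`, the slot before `z` and the comparison of `z` with `z′` are settled, so
  -- the window advances and their contributions pass into the accumulator and into the shifted `G`.
  insert-beyond : ∀ G p z z′ w x → noDoubleDescent (p ∷ z ∷ z′ ∷ w) ≡ true → z′ ≢ N → ∀ w′ →
    insertWeight G p z x (z′ ∷ w′) ≡ insertWeight (λ x y j → G x y (j + (if z′ <ᵇ z then 0 else 1))) z z′ (slotP p z (z′ ∷ w) ?∷ x) w′
  insert-beyond G p z z′ w x ndd z′≢N w′ rewrite ≢⇒≡ᵇ≡false z′≢N with not ((z <ᵇ p) ∧ (z′ <ᵇ z))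
  ... | true = refl

  insert-right : ∀ G p z zs x → z < N → All (Letter N) zs → noDoubleDescent (p ∷ z ∷ zs) ≡ true →
    ∑ (insertions N zs) (insertWeight G p z x)
      ≡ ∑R (fill G (asc (z ∷ zs))) (slotP p z zs ?∷ x) (slotsP z zs)
  insert-right G p z [] x z<N [] ndd = cong (_+ 0) (insert-end G p z x z<N)
  insert-right G p z (z′ ∷ zs) x z<N (lz′ ∷ lzs) ndd = begin
    insertWeight G p z x (N ∷ z′ ∷ zs) + ∑ (map (z′ ∷_) (insertions N zs)) (insertWeight G p z x)
      ≡⟨ cong₂ _+_ (insert-before G p z z′ zs x z<N lz′ ndd)
           (≡.trans (∑-map (z′ ∷_) (insertions N zs) (insertWeight G p z x))
             (∑-cong (All.universal (insert-beyond G p z z′ zs x ndd (<⇒≢ (proj₂ lz′))) (insertions N zs)))) ⟩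
    h + ∑ (insertions N zs) (insertWeight (λ x y j → G x y (j + a)) z z′ x′)
      ≡⟨ cong (h +_) (insert-right (λ x y j → G x y (j + a)) z z′ zs x′ (proj₂ lz′) lzs (proj₂ (∧≡true⇒ ndd))) ⟩
    h + ∑R (fill (λ x y j → G x y (j + a)) (asc (z′ ∷ zs))) (slotP z z′ zs ?∷ x′) (slotsP z′ zs)
      ≡⟨ cong (h +_) (∑R-cong (fill-shift G a (asc (z′ ∷ zs))) (slotP z z′ zs ?∷ x′) (slotsP z′ zs)) ⟩
    h + ∑R (fill G (asc (z ∷ z′ ∷ zs))) (slotP z z′ zs ?∷ x′) (slotsP z′ zs)
      ≡⟨ ∑R-?∷ (fill G (asc (z ∷ z′ ∷ zs))) (slotP z z′ zs) x′ (slotsP z′ zs) ⟨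
    ∑R (fill G (asc (z ∷ z′ ∷ zs))) x′ (slotsP z (z′ ∷ zs)) ∎
    where
    open ≡-Reasoning
    a : ℕ
    a = if z′ <ᵇ z then 0 else 1
    x′ : List Slot
    x′ = slotP p z (z′ ∷ zs) ?∷ x
    h : ℕ
    h = maybe′ (λ c → fill G (asc (z ∷ z′ ∷ zs)) x′ c (slotsP z′ zs)) 0 (slotP z z′ zs)

  precedes-∷ : ∀ m w → precedes m N (N ∷ w) ≡ false
  precedes-∷ m w rewrite ≡ᵇ-refl N = refl

  -- The `∑L` on the left side stands for the positions already passed. Each further letter before
  -- `m` moves one summand from the insertions into it; at `m` it is complete, and the remaining
  -- insertions form `∑R`.
  insert-all : ∀ m (G : Bool → List Slot → List Slot → ℕ → ℕ) p z zs x →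
    z < N → All (Letter N) zs → m ∈ zs → noDoubleDescent (p ∷ z ∷ zs) ≡ true →
    let x′ = slotP p z zs ?∷ x
        fᵇ = λ b → fill (G b) (asc (z ∷ zs))
    in ∑ (insertions N zs) (λ w → insertWeight (G (precedes m N w)) p z x w) + ∑L (fᵇ false) x′ (slotsP z zs)
         ≡ ∑L (fᵇ false) (leftFrom m x′ z zs) (rightP m zs) + ∑R (fᵇ true) (leftFrom m x′ z zs) (rightP m zs)
  insert-all m G p z (z′ ∷ zs) x z<N (lz′ ∷ lzs) m∈ ndd = begin
    insertWeight (G (precedes m N (N ∷ z′ ∷ zs))) p z x (N ∷ z′ ∷ zs)
      + ∑ (map (z′ ∷_) (insertions N zs)) (λ w → insertWeight (G (precedes m N w)) p z x w) + ∑L f x′ (slotsP z (z′ ∷ zs))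
      ≡⟨ cong (_+ ∑L f x′ (slotsP z (z′ ∷ zs))) (cong₂ _+_ first beyond) ⟩
    h + rest + ∑L f x′ (slotP z z′ zs ?∷ slotsP z′ zs)
      ≡⟨ cong (_+ ∑L f x′ (slotP z z′ zs ?∷ slotsP z′ zs)) (+-comm h rest) ⟩
    rest + h + ∑L f x′ (slotP z z′ zs ?∷ slotsP z′ zs)
      ≡⟨ +-assoc rest h _ ⟩
    rest + (h + ∑L f x′ (slotP z z′ zs ?∷ slotsP z′ zs))
      ≡⟨ cong (rest +_) (∑L-?∷ f (slotP z z′ zs) x′ (slotsP z′ zs)) ⟨
    rest + ∑L f (slotP z z′ zs ?∷ x′) (slotsP z′ zs)
      ≡⟨ passing (z′ ≟ m) m∈ ⟩
    ∑L f (leftFrom m x′ z (z′ ∷ zs)) (rightP m (z′ ∷ zs)) + ∑R fᵗ (leftFrom m x′ z (z′ ∷ zs)) (rightP m (z′ ∷ zs)) ∎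
    where
    open ≡-Reasoning
    a : ℕ
    a = if z′ <ᵇ z then 0 else 1
    x′ : List Slot
    x′ = slotP p z (z′ ∷ zs) ?∷ x
    f fᵗ : List Slot → Slot → List Slot → ℕ
    f  = fill (G false) (asc (z ∷ z′ ∷ zs))
    fᵗ = fill (G true) (asc (z ∷ z′ ∷ zs))
    h : ℕ
    h = maybe′ (λ c → f x′ c (slotsP z′ zs)) 0 (slotP z z′ zs)
    G⁺ : Bool → List Slot → List Slot → ℕ → ℕ
    G⁺ b x y j = G b x y (j + a)
    rest : ℕ
    rest = ∑ (insertions N zs) (λ w → insertWeight (G⁺ (precedes m N (z′ ∷ w))) z z′ x′ w)
    ndd′ : noDoubleDescent (z ∷ z′ ∷ zs) ≡ true
    ndd′ = proj₂ (∧≡true⇒ ndd)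
    first : insertWeight (G (precedes m N (N ∷ z′ ∷ zs))) p z x (N ∷ z′ ∷ zs) ≡ h
    first = ≡.trans (cong (λ b → insertWeight (G b) p z x (N ∷ z′ ∷ zs)) (precedes-∷ m (z′ ∷ zs))) (insert-before (G false) p z z′ zs x z<N lz′ ndd)
    beyond : ∑ (map (z′ ∷_) (insertions N zs)) (λ w → insertWeight (G (precedes m N w)) p z x w) ≡ rest
    beyond = ≡.trans (∑-map (z′ ∷_) (insertions N zs) _)
      (∑-cong (All.universal (λ w → insert-beyond (G (precedes m N (z′ ∷ w))) p z z′ zs x ndd (<⇒≢ (proj₂ lz′)) w) (insertions N zs)))
    passing : Dec (z′ ≡ m) → m ∈ z′ ∷ zs → rest + ∑L f (slotP z z′ zs ?∷ x′) (slotsP z′ zs)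
      ≡ ∑L f (leftFrom m x′ z (z′ ∷ zs)) (rightP m (z′ ∷ zs)) + ∑R fᵗ (leftFrom m x′ z (z′ ∷ zs)) (rightP m (z′ ∷ zs))
    -- The letter at the bar is reached: every remaining position puts `N` to its right, so the flag
    -- is `true` from here on.
    passing (yes refl) _
      rewrite ≢⇒≡ᵇ≡false (<⇒≢ (proj₂ lz′)) | ≡ᵇ-refl z′
            | insert-right (G⁺ true) z z′ zs x′ (proj₂ lz′) lzs ndd′
            | ∑R-cong (fill-shift (G true) a (asc (z′ ∷ zs))) (slotP z z′ zs ?∷ x′) (slotsP z′ zs)
      = +-comm (∑R fᵗ (slotP z z′ zs ?∷ x′) (slotsP z′ zs)) _
    passing (no z′≢m) (here eq) = contradiction (sym eq) z′≢m
    passing (no z′≢m) (there m∈zs)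
      rewrite ≢⇒≡ᵇ≡false (<⇒≢ (proj₂ lz′)) | ≢⇒≡ᵇ≡false z′≢m
            | sym (∑L-cong (fill-shift (G false) a (asc (z′ ∷ zs))) (slotP z z′ zs ?∷ x′) (slotsP z′ zs))
            | sym (∑L-cong (fill-shift (G false) a (asc (z′ ∷ zs))) (leftFrom m (slotP z z′ zs ?∷ x′) z′ zs) (rightP m zs))
            | sym (∑R-cong (fill-shift (G true) a (asc (z′ ∷ zs))) (leftFrom m (slotP z z′ zs ?∷ x′) z′ zs) (rightP m zs))
      = insert-all m G⁺ z z′ zs x′ (proj₂ lz′) lzs m∈zs ndd′

-- Permutations built by insertion

data Inserted (N : ℕ) : List ℕ → List ℕ → Set where
  here  : ∀ {w} → Inserted N w (N ∷ w)
  there : ∀ {y w w′} → Inserted N w w′ → Inserted N (y ∷ w) (y ∷ w′)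

insertions-Inserted : ∀ N w → All (Inserted N w) (insertions N w)
insertions-Inserted N []      = here ∷ []
insertions-Inserted N (y ∷ w) = here ∷ All.map⁺ (All.map there (insertions-Inserted N w))

module _ {N : ℕ} where

  length-Inserted : ∀ {w w′} → Inserted N w w′ → length w′ ≡ suc (length w)
  length-Inserted here      = refl
  length-Inserted (there i) = cong suc (length-Inserted i)

  All-Inserted : ∀ {P : ℕ → Set} {w w′} → Inserted N w w′ → P N → All P w → All P w′
  All-Inserted here      pN ps       = pN ∷ ps
  All-Inserted (there i) pN (p ∷ ps) = p ∷ All-Inserted i pN ps

  ∈-Inserted : ∀ {v w w′} → Inserted N w w′ → v ∈ w → v ∈ w′
  ∈-Inserted here      v∈         = there v∈
  ∈-Inserted (there i) (here eq)  = here eq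
  ∈-Inserted (there i) (there v∈) = there (∈-Inserted i v∈)

  inserted-∈ : ∀ {w w′} → Inserted N w w′ → N ∈ w′
  inserted-∈ here      = here refl
  inserted-∈ (there i) = there (inserted-∈ i)

  restrict-Inserted : ∀ {k w w′} → k < N → Inserted N w w′ → restrict k w′ ≡ restrict k w
  restrict-Inserted {k} k<N here with N ≤ᵇ k in eq
  ... | true  = contradiction (≤ᵇ≡true⇒≤ eq) (<⇒≱ k<N)
  ... | false = refl
  restrict-Inserted {k} k<N (there {y} i) with y ≤ᵇ k
  ... | true  = cong (y ∷_) (restrict-Inserted k<N i)
  ... | false = restrict-Inserted k<N i

record IsPermutation (m : ℕ) (w : List ℕ) : Set where
  field
    size     : length w ≡ m
    letters  : All (Letter (suc m)) w
    complete : ∀ {v} → 0 < v → v ≤ m → v ∈ w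

open IsPermutation

perms-isPermutation : ∀ m → All (IsPermutation m) (perms m)
perms-isPermutation zero = record
  { size = refl ; letters = [] ; complete = λ 0<v v≤0 → contradiction v≤0 (<⇒≱ 0<v) } ∷ []
perms-isPermutation (suc m) = All.concat⁺ (All.map⁺ (All.map
  (λ {w} perm → All.map (insert perm) (insertions-Inserted (suc m) w)) (perms-isPermutation m)))
  where
  insert : ∀ {w w′} → IsPermutation m w → Inserted (suc m) w w′ → IsPermutation (suc m) w′
  insert {w} {w′} perm i = record
    { size     = ≡.trans (length-Inserted i) (cong suc (size perm))
    ; letters  = All-Inserted i (z<s , ≤-refl) (All.map (λ (0<v , v<) → 0<v , m<n⇒m<1+n v<) (letters perm))
    ; complete = occurs
    }
    where
    occurs : ∀ {v} → 0 < v → v ≤ suc m → v ∈ w′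
    occurs {v} 0<v v≤ with v ≟ suc m
    ... | yes refl = inserted-∈ i
    ... | no  v≢   = ∈-Inserted i (complete perm 0<v (≤-pred (≤∧≢⇒< v≤ v≢)))

-- The Simsun condition under insertion

restrict-all : ∀ {m w} → All (Letter (suc m)) w → restrict m w ≡ w
restrict-all [] = refl
restrict-all {m} {v ∷ w} ((_ , s≤s v≤m) ∷ ls) rewrite ≤⇒≤ᵇ≡true v≤m = cong (v ∷_) (restrict-all ls)

and-applyUpTo-suc : ∀ (h : ℕ → Bool) k → and (applyUpTo h (suc k)) ≡ and (applyUpTo h k) ∧ h k
and-applyUpTo-suc h zero    = ∧-identityʳ (h 0)
and-applyUpTo-suc h (suc k) =
  ≡.trans (cong (h 0 ∧_) (and-applyUpTo-suc (h ∘ suc) k)) (sym (∧-assoc (h 0) _ _))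

applyUpTo-cong : ∀ {A : Set} {g h : ℕ → A} k → (∀ {i} → i < k → g i ≡ h i) → applyUpTo g k ≡ applyUpTo h k
applyUpTo-cong zero    eq = refl
applyUpTo-cong (suc k) eq = cong₂ _∷_ (eq z<s) (applyUpTo-cong k (eq ∘ s<s))

isSimsun-last : ∀ {m w} → IsPermutation (suc m) w →
  isSimsun w ≡ and (applyUpTo (λ j → noDoubleDescent (restrict (suc j) w)) m) ∧ noDoubleDescent w
isSimsun-last {m} {w} perm = begin
  and (map h (upTo (length w)))      ≡⟨ cong and (map-upTo h (length w)) ⟩
  and (applyUpTo h (length w))       ≡⟨ cong (and ∘ applyUpTo h) (size perm) ⟩
  and (applyUpTo h (suc m))          ≡⟨ and-applyUpTo-suc h m ⟩
  and (applyUpTo h m) ∧ h m          ≡⟨ cong (λ u → and (applyUpTo h m) ∧ noDoubleDescent u) (restrict-all (letters perm)) ⟩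
  and (applyUpTo h m) ∧ noDoubleDescent w ∎
  where
  open ≡-Reasoning
  h : ℕ → Bool
  h j = noDoubleDescent (restrict (suc j) w)

-- Restrictions to values up to `m` discard the inserted letter and agree with those of `w`; only
-- the test of the full word is added.
isSimsun-Inserted : ∀ {m w w′} → IsPermutation m w → IsPermutation (suc m) w′ → Inserted (suc m) w w′ →
  isSimsun w′ ≡ isSimsun w ∧ noDoubleDescent w′
isSimsun-Inserted {m} {w} {w′} perm perm′ i = ≡.trans (isSimsun-last perm′) (cong (_∧ noDoubleDescent w′) (begin
  and (applyUpTo (λ j → noDoubleDescent (restrict (suc j) w′)) m)
    ≡⟨ cong and (applyUpTo-cong m (λ j<m → cong noDoubleDescent (restrict-Inserted (s<s j<m) i))) ⟩
  and (applyUpTo (λ j → noDoubleDescent (restrict (suc j) w)) m)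
    ≡⟨ cong (λ l → and (applyUpTo _ l)) (size perm) ⟨
  and (applyUpTo (λ j → noDoubleDescent (restrict (suc j) w)) (length w))
    ≡⟨ cong and (map-upTo _ (length w)) ⟨
  isSimsun w ∎))
  where open ≡-Reasoning

-- Ascents of the inverse under insertion

asc-applyUpTo-suc : ∀ (P : ℕ → ℕ) k →
  asc (applyUpTo P (2 + k)) ≡ asc (applyUpTo P (suc k)) + (if P (suc k) <ᵇ P k then 0 else 1)
asc-applyUpTo-suc P zero    = refl
asc-applyUpTo-suc P (suc k) = begin
  asc (applyUpTo (P ∘ suc) (2 + k)) + a       ≡⟨ cong (_+ a) (asc-applyUpTo-suc (P ∘ suc) k) ⟩
  asc (applyUpTo (P ∘ suc) (suc k)) + b + a   ≡⟨ +-assoc (asc (applyUpTo (P ∘ suc) (suc k))) b a ⟩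
  asc (applyUpTo (P ∘ suc) (suc k)) + (b + a) ≡⟨ cong (asc (applyUpTo (P ∘ suc) (suc k)) +_) (+-comm b a) ⟩
  asc (applyUpTo (P ∘ suc) (suc k)) + (a + b) ≡⟨ +-assoc (asc (applyUpTo (P ∘ suc) (suc k))) a b ⟨
  asc (applyUpTo (P ∘ suc) (suc k)) + a + b   ∎
  where
  open ≡-Reasoning
  a b : ℕ
  a = if P 1 <ᵇ P 0 then 0 else 1
  b = if P (2 + k) <ᵇ P (suc k) then 0 else 1

asc-applyUpTo-cong : ∀ (P Q : ℕ → ℕ) k → (∀ {j} → suc j < k → (P (suc j) <ᵇ P j) ≡ (Q (suc j) <ᵇ Q j)) →
  asc (applyUpTo P k) ≡ asc (applyUpTo Q k)
asc-applyUpTo-cong P Q 0             eq = refl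
asc-applyUpTo-cong P Q 1             eq = refl
asc-applyUpTo-cong P Q (suc (suc k)) eq =
  cong₂ (λ l b → l + (if b then 0 else 1)) (asc-applyUpTo-cong (P ∘ suc) (Q ∘ suc) (suc k) (eq ∘ s<s)) (eq (s<s z<s))

-- `posOf` counts from 1 and takes the default 0 only on the empty word; the member `u` excludes
-- that case.
0<ᵇposOf : ∀ {v u w} → u ∈ w → (0 <ᵇ posOf v w) ≡ true
0<ᵇposOf {v} {w = x ∷ w} _ with x ≡ᵇ v
... | true  = refl
... | false = refl

tail-∈ : ∀ {v x w} → v ∈ x ∷ w → (x ≡ᵇ v) ≡ false → v ∈ w
tail-∈ {v} (here refl) eq with () ← ≡.trans (sym (≡ᵇ-refl v)) eq
tail-∈     (there v∈)  eq = v∈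

posOf-Inserted : ∀ {N a b w w′} → a ≢ N → b ≢ N → b ∈ w → Inserted N w w′ →
  (posOf a w′ <ᵇ posOf b w′) ≡ (posOf a w <ᵇ posOf b w)
posOf-Inserted a≢N b≢N b∈ here rewrite ≢⇒≡ᵇ≡false (a≢N ∘ sym) | ≢⇒≡ᵇ≡false (b≢N ∘ sym) = refl
posOf-Inserted {a = a} {b} a≢N b≢N b∈ (there {y} i) with y ≡ᵇ a | y ≡ᵇ b in eq
... | true  | true  = refl
... | true  | false = ≡.trans (0<ᵇposOf (∈-Inserted i (tail-∈ b∈ eq))) (sym (0<ᵇposOf (tail-∈ b∈ eq)))
... | false | true  = refl
... | false | false = posOf-Inserted a≢N b≢N (tail-∈ b∈ eq) i

posOf-precedes : ∀ {m N w} → m ≢ N → m ∈ w → (posOf N w <ᵇ posOf m w) ≡ not (precedes m N w)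
posOf-precedes {m} {N} {z ∷ w} m≢N m∈ with z ≡ᵇ N in eqN | z ≡ᵇ m in eqm
... | true  | true  = contradiction (≡.trans (sym (≡ᵇ⇒≡ z m (Equivalence.from T-≡ eqm))) (≡ᵇ⇒≡ z N (Equivalence.from T-≡ eqN))) m≢N
... | true  | false = 0<ᵇposOf (tail-∈ m∈ eqm)
... | false | true  = refl
... | false | false = posOf-precedes m≢N (tail-∈ m∈ eqm)

iasc-applyUpTo : ∀ {m w} → IsPermutation m w → iasc w ≡ asc (applyUpTo (λ j → posOf (suc j) w) m)
iasc-applyUpTo {m} {w} perm = ≡.trans (ascP≡asc (inverse w))
  (≡.trans (cong asc (map-upTo _ (length w))) (cong (λ l → asc (applyUpTo (λ j → posOf (suc j) w) l)) (size perm)))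

-- Insertion keeps the relative order of the old letters, so the comparisons of their positions
-- persist. The one new comparison is between the two largest values, an ascent exactly when `suc m`
-- stands left of `2 + m`.
iasc-Inserted : ∀ {m w w′} → IsPermutation (suc m) w → IsPermutation (2 + m) w′ → Inserted (2 + m) w w′ →
  iasc w′ ≡ (if precedes (suc m) (2 + m) w′ then suc (iasc w) else iasc w)
iasc-Inserted {m} {w} {w′} perm perm′ i = begin
  iasc w′
    ≡⟨ iasc-applyUpTo perm′ ⟩
  asc (applyUpTo (λ j → posOf (suc j) w′) (2 + m))
    ≡⟨ asc-applyUpTo-suc (λ j → posOf (suc j) w′) m ⟩
  asc (applyUpTo (λ j → posOf (suc j) w′) (suc m)) + (if posOf (2 + m) w′ <ᵇ posOf (suc m) w′ then 0 else 1)
    ≡⟨ cong₂ (λ l b → l + (if b then 0 else 1))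
         (asc-applyUpTo-cong (λ j → posOf (suc j) w′) (λ j → posOf (suc j) w) (suc m) (λ {j} j<m → posOf-Inserted (<⇒≢ (s<s j<m)) (<⇒≢ (s<s (<⇒≤ j<m))) (complete perm z<s (<⇒≤ j<m)) i))
         (posOf-precedes (<⇒≢ ≤-refl) (complete perm′ z<s (n≤1+n _))) ⟩
  asc (applyUpTo (λ j → posOf (suc j) w) (suc m)) + (if not (precedes (suc m) (2 + m) w′) then 0 else 1)
    ≡⟨ cong (_+ (if not (precedes (suc m) (2 + m) w′) then 0 else 1)) (iasc-applyUpTo perm) ⟨
  iasc w + (if not (precedes (suc m) (2 + m) w′) then 0 else 1)
    ≡⟨ indicator (precedes (suc m) (2 + m) w′) ⟩
  (if precedes (suc m) (2 + m) w′ then suc (iasc w) else iasc w) ∎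
  where
  open ≡-Reasoning
  indicator : ∀ b → iasc w + (if not b then 0 else 1) ≡ (if b then suc (iasc w) else iasc w)
  indicator true  = +-comm (iasc w) 1
  indicator false = +-identityʳ (iasc w)

-- One step of growth for Simsun permutations

weightP : (ℕ → ℕ → ℕ) → ℕ → ℕ → List ℕ → ℕ
weightP φ n m w = F φ n (leftFrom m [] 0 w) (rightP m w) (iasc w) (ascP w)

module _ (φ : ℕ → ℕ → ℕ) (n m : ℕ) where

  private
    N : ℕ
    N = 2 + m

    -- The sentinel 0 in front of the word contributes one ascent, which G discounts.
    G : List ℕ → Bool → List Slot → List Slot → ℕ → ℕ
    G w b x y j = F φ n x y (if b then suc (iasc w) else iasc w) (j ∸ 1)

  -- The scan starts with both window letters equal to the sentinel 0, which has no slot and takes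
  -- part in no descent with what follows.
  weight-Inserted : ∀ {w w′} → IsPermutation (suc m) w → IsPermutation N w′ → Inserted N w w′ →
    (if noDoubleDescent w′ then weightP φ n N w′ else 0)
      ≡ insertWeight N (G w (precedes (suc m) N w′)) 0 0 [] w′
  weight-Inserted {w} {x ∷ w′} perm perm′ i = begin
    (if noDoubleDescent (x ∷ w′) then weightP φ n N (x ∷ w′) else 0)
      ≡⟨ cong₂ (λ b t → if b then t else 0) (sym (noDoubleDescent-∷∷ 0 x w′))
           (cong₂ (F φ n _ _) (iasc-Inserted perm perm′ i)
             (≡.trans (ascP≡asc (x ∷ w′)) (sym (m+n∸n≡m (asc (x ∷ w′)) 1)))) ⟩
    insertWeight N (G w (precedes (suc m) N (x ∷ w′))) 0 0 [] (x ∷ w′) ∎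
    where open ≡-Reasoning

  insertions-weight : ∀ {w} → IsPermutation (suc m) w → All (IsPermutation N) (insertions N w) → noDoubleDescent w ≡ true →
    ∑ (insertions N w) (λ w′ → if noDoubleDescent w′ then weightP φ n N w′ else 0) ≡ weightP φ (suc n) (suc m) w
  insertions-weight {x ∷ w} perm perms′ ndd = begin
    ∑ (insertions N (x ∷ w)) (λ w′ → if noDoubleDescent w′ then weightP φ n N w′ else 0)
      ≡⟨ ∑-cong (All.zipWith (λ (perm′ , i) → weight-Inserted perm perm′ i) (perms′ , insertions-Inserted N (x ∷ w))) ⟩
    ∑ (insertions N (x ∷ w)) (λ w′ → insertWeight N (G (x ∷ w) (precedes (suc m) N w′)) 0 0 [] w′)
      -- The added 0 is the `∑L` of `insert-all` over the initially empty list of passed slots.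
      ≡⟨ +-identityʳ _ ⟨
    ∑ (insertions N (x ∷ w)) (λ w′ → insertWeight N (G (x ∷ w) (precedes (suc m) N w′)) 0 0 [] w′) + 0
      ≡⟨ insert-all N (suc m) (G (x ∷ w)) 0 0 (x ∷ w) [] z<s (letters perm) (complete perm z<s ≤-refl) (≡.trans (noDoubleDescent-∷∷ 0 x w) ndd) ⟩
    ∑L (fill (G (x ∷ w) false) (asc (x ∷ w) + 1)) X Y + ∑R (fill (G (x ∷ w) true) (asc (x ∷ w) + 1)) X Y
      ≡⟨ cong₂ _+_ (∑L-cong (discount false) X Y) (∑R-cong (discount true) X Y) ⟩
    weightP φ (suc n) (suc m) (x ∷ w) ∎
    where
    open ≡-Reasoning
    X Y : List Slot
    X = leftFrom (suc m) [] 0 (x ∷ w)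
    Y = rightP (suc m) (x ∷ w)
    discount : ∀ b x′ c y → fill (G (x ∷ w) b) (asc (x ∷ w) + 1) x′ c y
      ≡ fill (λ x′ y j → F φ n x′ y (if b then suc (iasc (x ∷ w)) else iasc (x ∷ w)) j) (ascP (x ∷ w)) x′ c y
    discount b x′ c y rewrite ascP≡asc (x ∷ w) | +-comm (asc (x ∷ w)) 1 with c
    ... | new = refl
    ... | old = refl

  RS-step : ∑ (RS N) (weightP φ n N) ≡ ∑ (RS (suc m)) (weightP φ (suc n) (suc m))
  RS-step = begin
    ∑ (RS N) (weightP φ n N)
      ≡⟨ ∑-filterᵇ isSimsun (perms N) (weightP φ n N) ⟩
    ∑ (perms N) g
      ≡⟨ ∑-concatMap (insertions N) (perms (suc m)) g ⟩
    ∑ (perms (suc m)) (λ w → ∑ (insertions N w) g)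
      ≡⟨ ∑-cong (All.zipWith (λ {w} (perm , perms′) → step w perm perms′)
           (perms-isPermutation (suc m) , All.map⁻ (All.concat⁻ (perms-isPermutation N)))) ⟩
    ∑ (perms (suc m)) (λ w → if isSimsun w then weightP φ (suc n) (suc m) w else 0)
      ≡⟨ ∑-filterᵇ isSimsun (perms (suc m)) (weightP φ (suc n) (suc m)) ⟨
    ∑ (RS (suc m)) (weightP φ (suc n) (suc m)) ∎
    where
    open ≡-Reasoning
    g : List ℕ → ℕ
    g w = if isSimsun w then weightP φ n N w else 0
    step : ∀ w → IsPermutation (suc m) w → All (IsPermutation N) (insertions N w) →
      ∑ (insertions N w) g ≡ (if isSimsun w then weightP φ (suc n) (suc m) w else 0)
    step w perm perms′ = ≡.trans
      (∑-cong (All.zipWith (λ {w′} (perm′ , i) → cong (λ b → if b then weightP φ n N w′ else 0) (isSimsun-Inserted perm perm′ i))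
        (perms′ , insertions-Inserted N w)))
      (cases (isSimsun w) refl)
      where
      cases : ∀ b → isSimsun w ≡ b →
        ∑ (insertions N w) (λ w′ → if b ∧ noDoubleDescent w′ then weightP φ n N w′ else 0) ≡ (if b then weightP φ (suc n) (suc m) w else 0)
      cases true  eq = insertions-weight perm perms′ (proj₂ (∧≡true⇒ (≡.trans (sym (isSimsun-last perm)) eq)))
      cases false eq = ∑-zero (insertions N w)

∑-RS : ∀ φ n m → ∑ (RS (n + suc m)) (λ w → φ (iasc w) (ascP w)) ≡ ∑ (RS (suc m)) (weightP φ n (suc m))
∑-RS φ zero    m = refl
∑-RS φ (suc n) m = begin
  ∑ (RS (suc n + suc m)) (λ w → φ (iasc w) (ascP w)) ≡⟨ cong (λ l → ∑ (RS l) (λ w → φ (iasc w) (ascP w))) (+-suc n (suc m)) ⟨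
  ∑ (RS (n + (2 + m))) (λ w → φ (iasc w) (ascP w))   ≡⟨ ∑-RS φ n (suc m) ⟩
  ∑ (RS (2 + m)) (weightP φ n (2 + m))               ≡⟨ RS-step φ n m ⟩
  ∑ (RS (suc m)) (weightP φ (suc n) (suc m))         ∎
  where open ≡-Reasoning

-- Comparison of the two families

theorem5p2 : (n : ℕ) → 1 ≤ n → (a b : ℕ) →
    coeff iasc ascP (RS n) a b ≡ coeff ascI dist (I000 n) a b
theorem5p2 (suc n) _ a b = begin
  coeff iasc ascP (RS (suc n)) a b                    ≡⟨ length-filterᵇ _ (RS (suc n)) ⟩
  ∑ (RS (suc n)) (λ w → φ (iasc w) (ascP w))          ≡⟨ cong (λ l → ∑ (RS l) (λ w → φ (iasc w) (ascP w))) (+-comm n 1) ⟨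
  ∑ (RS (n + 1)) (λ w → φ (iasc w) (ascP w))          ≡⟨ ∑-RS φ n 0 ⟩
  -- The word 1 and the sequence 0 have the same state, `old` left and `new` right of the bar, with
  -- both statistics 0. The final `+ 0` closes a sum with one term.
  F φ n (old ∷ []) (new ∷ []) 0 0 + 0                 ≡⟨ ∑-I000 φ n 0 ⟨
  ∑ (I000 (n + 1)) (λ e → φ (ascI e) (dist e))        ≡⟨ cong (λ l → ∑ (I000 l) (λ e → φ (ascI e) (dist e))) (+-comm n 1) ⟩
  ∑ (I000 (suc n)) (λ e → φ (ascI e) (dist e))        ≡⟨ length-filterᵇ _ (I000 (suc n)) ⟨
  coeff ascI dist (I000 (suc n)) a b                  ∎
  where
  open ≡-Reasoning
  -- The indicator of the exponent pair turns the sums of `φ` into coefficients.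
  φ : ℕ → ℕ → ℕ
  φ i j = if (i ≡ᵇ a) ∧ (j ≡ᵇ b) then 1 else 0
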